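{- $(\mathcal{N},\sim_V)\models\forall\mathsf{x}\forall\mathsf{y}[\neg AP(\mathsf{x},\mathsf{y})]$; that is, for all $\alpha,\beta\in\mathcal{N}$ it is not the case that $\forall\gamma[\neg(\gamma\sim_V\alpha)\vee\neg(\gamma\sim_V\beta)]$.
   Context: Intuitionistic mathematics (constructive reading of logical constants; Markov's Principle not assumed), with Brouwer's Continuity Principle as an axiom (for every $R\subseteq\mathcal{N}\times\omega$, if $\forall\alpha\exists n[\alpha Rn]$ then $\forall\alpha\exists m\exists n\forall\beta[\overline{\alpha}m\sqsubset\beta\rightarrow\beta Rn]$, where $\overline{\alpha}m=\langle\alpha(0),\dots,\alpha(m-1)\rangle$ and $\sqsubset$ is "initial segment of"). $\mathcal{N}=\omega^\omega$; $\alpha\sim_V\beta$ iff $\exists n\forall m>n[\alpha(m)=\beta(m)]$. $AP(\mathsf{x},\mathsf{y})$ is the formula $\forall\mathsf{z}[\neg(\mathsf{z}=\mathsf{x})\vee\neg(\mathsf{z}=\mathsf{y})]$, with $=$ interpreted by $\sim_V$; satisfaction read intuitionistically. -}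

module Defs where

open import Level using (Level; 0ℓ; _⊔_) renaming (suc to lsuc)
open import Data.Fin using (Fin; zero; suc)
open import Data.List using (List; applyUpTo)
open import Data.Nat using (ℕ; _>_)
open import Data.Product using (Σ; _×_)
open import Data.Sum using (_⊎_)
open import Data.Vec using (Vec; []; _∷_; lookup)
open import Relation.Binary using (Rel; REL; Irrelevant)
open import Relation.Binary.PropositionalEquality using (_≡_; refl)
import Relation.Nullary as Nullary
open Nullary using (¬_)

private
  variable
    a b : Level
    n : ℕ

-- The intuitionistic ∃ and ∨ are rendered as truncated Σ and ⊎.  With bare Σ
-- in place of ∃, Brouwer's Continuity Principle is refutable in type theory
-- (Escardó and Xu, 2015), and anything assuming it would hold vacuously.
-- Truncation is encoded impredicatively: ∥ A ∥ may be used to prove any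
-- proposition (type with at most one element).  P ranges over Set only, so
-- that iterated truncation, as in Sat below, stays in Set₁.
∥_∥ : Set a → Set (a ⊔ lsuc 0ℓ)
∥ A ∥ = (P : Set) → Nullary.Irrelevant P → (A → P) → P

∃ : {A : Set a} → (A → Set b) → Set (a ⊔ b ⊔ lsuc 0ℓ)
∃ {A = A} B = ∥ Σ A B ∥

infix 2 ∃-syntax
∃-syntax : {A : Set a} → (A → Set b) → Set (a ⊔ b ⊔ lsuc 0ℓ)
∃-syntax = ∃

syntax ∃-syntax (λ x → B) = ∃[ x ] B

infixr 1 _∨_
_∨_ : Set a → Set b → Set (a ⊔ b ⊔ lsuc 0ℓ)
A ∨ B = ∥ A ⊎ B ∥

𝒩 : Set
𝒩 = ℕ → ℕ

-- initial α m = ⟨ α 0 , … , α (m - 1) ⟩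
initial : 𝒩 → ℕ → List ℕ
initial = applyUpTo

infix 4 _⊏_
_⊏_ : List ℕ → 𝒩 → Set₁
s ⊏ β = ∃[ k ] initial β k ≡ s

-- Irrelevant R says that R is proposition-valued, i.e. a subset of 𝒩 × ℕ.
BrouwerContinuityPrinciple : Set₁
BrouwerContinuityPrinciple =
  (R : REL 𝒩 ℕ 0ℓ) → Irrelevant R →
  (∀ α → ∃[ n ] R α n) →
  ∀ α → ∃[ m ] ∃[ n ] (∀ β → initial α m ⊏ β → R β n)

infix 4 _∼V_
_∼V_ : Rel 𝒩 (lsuc 0ℓ)
α ∼V β = ∃[ n ] (∀ m → m > n → α m ≡ β m)

-- First-order formulas in the language of equality, with n free variables
-- (de Bruijn indices: zero is the innermost bound variable).
infix  7 _≐_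
infix  6 `¬_
infixr 5 _`∧_
infixr 4 _`∨_
infixr 3 _`⇒_
infix  2 `∀_ `∃_

data Formula (n : ℕ) : Set where
  _≐_            : Fin n → Fin n → Formula n
  `¬_            : Formula n → Formula n
  _`∧_ _`∨_ _`⇒_ : Formula n → Formula n → Formula n
  `∀_ `∃_        : Formula (ℕ.suc n) → Formula n

module Satisfaction (A : Set) (_≈_ : Rel A (lsuc 0ℓ)) where

  Sat : Vec A n → Formula n → Set₁
  Sat ρ (x ≐ y)  = lookup ρ x ≈ lookup ρ y
  Sat ρ (`¬ φ)   = ¬ Sat ρ φ
  Sat ρ (φ `∧ ψ) = Sat ρ φ × Sat ρ ψ
  Sat ρ (φ `∨ ψ) = Sat ρ φ ∨ Sat ρ ψ
  Sat ρ (φ `⇒ ψ) = Sat ρ φ → Sat ρ ψ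
  Sat ρ (`∀ φ)   = (a : A) → Sat (a ∷ ρ) φ
  Sat ρ (`∃ φ)   = ∃[ a ] Sat (a ∷ ρ) φ

infix 1 ⟨_,_⟩⊨_
⟨_,_⟩⊨_ : (A : Set) → Rel A (lsuc 0ℓ) → Formula 0 → Set₁
⟨ A , _≈_ ⟩⊨ φ = Satisfaction.Sat A _≈_ [] φ

AP : Fin n → Fin n → Formula n
AP x y = `∀ (`¬ (zero ≐ suc x) `∨ `¬ (zero ≐ suc y))

_ : (⟨ 𝒩 , _∼V_ ⟩⊨ `∀ `∀ `¬ AP (suc zero) zero)
    ≡ (∀ α β → ¬ (∀ γ → ¬ (γ ∼V α) ∨ ¬ (γ ∼V β)))
_ = refl

{-# OPTIONS --safe #-}
-- If every γ were apart from α or from β, then by continuity some initial segment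
-- of α would decide, for all its extensions γ at once, which of the two γ is apart
-- from.  But the segment can be continued by the chosen sequence itself.
module Submission where

open import Defs
open import Data.Empty using (⊥)
open import Data.Fin using (zero; suc)
open import Data.List using (_∷_)
open import Data.Nat using (ℕ; zero; suc; _>_; _≥_; s≤s)
open import Data.Nat.Properties using (<⇒≤)
open import Data.Product using (Σ; _,_)
open import Data.Sum using (inj₁; inj₂)
open import Function using (_∘_)
open import Relation.Binary.PropositionalEquality using (_≡_; refl; cong)
open import Relation.Nullary using (¬_)

-- BrouwerContinuityPrinciple only takes relations valued in Set, whereas _∼V_ lives
-- in Set₁; the two agree under a negation.
EventuallyEqual : 𝒩 → 𝒩 → Set
EventuallyEqual α β = Σ ℕ λ n → ∀ m → m > n → α m ≡ β m

¬∼V⇒¬EventuallyEqual : ∀ {α β} → ¬ (α ∼V β) → ¬ EventuallyEqual α β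
¬∼V⇒¬EventuallyEqual α≁β e = α≁β (λ _ _ k → k e)

splice : ℕ → 𝒩 → 𝒩 → 𝒩
splice zero    α β         = β
splice (suc m) α β zero    = α zero
splice (suc m) α β (suc i) = splice m (α ∘ suc) (β ∘ suc) i

initial-splice : ∀ m α β → initial (splice m α β) m ≡ initial α m
initial-splice zero    α β = refl
initial-splice (suc m) α β = cong (α zero ∷_) (initial-splice m (α ∘ suc) (β ∘ suc))

splice-≥ : ∀ m α β i → i ≥ m → splice m α β i ≡ β i
splice-≥ zero    α β i       _         = refl
splice-≥ (suc m) α β (suc i) (s≤s i≥m) = splice-≥ m (α ∘ suc) (β ∘ suc) i i≥m

splice-eventuallyEqual : ∀ m α β → EventuallyEqual (splice m α β) β
splice-eventuallyEqual m α β = m , λ i i>m → splice-≥ m α β i (<⇒≤ i>m)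

-- The refl proving irrelevance relies on ⊥ having definitionally equal elements,
-- which makes any two functions into ⊥ equal without function extensionality.
no-apartness-selection : BrouwerContinuityPrinciple → (δ : ℕ → 𝒩) →
                         ¬ (∀ γ → ∃[ n ] ¬ EventuallyEqual γ (δ n))
no-apartness-selection bcp δ apart =
  -- Continuity is applied at `δ 0`; the truncations can be opened because the goal `⊥` is a
  -- proposition.
  bcp (λ γ n → ¬ EventuallyEqual γ (δ n)) (λ _ _ → refl) apart (δ 0) ⊥ (λ _ _ → refl)
    λ (m , ∃n) → ∃n ⊥ (λ _ _ → refl)
      -- The splice begins with the segment of `δ 0`, so `decided` applies to it, yet its tail is
      -- that of the selected `δ n`.
      λ (n , decided) → decided (splice m (δ 0) (δ n))
        (λ _ _ k → k (m , initial-splice m (δ 0) (δ n)))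
        (splice-eventuallyEqual m (δ 0) (δ n))

theorem9p3 : BrouwerContinuityPrinciple → ⟨ 𝒩 , _∼V_ ⟩⊨ `∀ `∀ `¬ AP (suc zero) zero
theorem9p3 bcp α β ap = no-apartness-selection bcp δ apart
  where
  -- Turns the disjunction into a choice of index, as continuity requires: 0 stands for `α`, any
  -- other index for `β`.
  δ : ℕ → 𝒩
  δ zero    = α
  δ (suc _) = β

  apart : ∀ γ → ∃[ n ] ¬ EventuallyEqual γ (δ n)
  apart γ P P-irrelevant k = ap γ P P-irrelevant λ where
    (inj₁ γ≁α) → k (0 , ¬∼V⇒¬EventuallyEqual γ≁α)
    (inj₂ γ≁β) → k (1 , ¬∼V⇒¬EventuallyEqual γ≁β)
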